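{- Let $w\ge 1$, $s\ge w+4$, and let $L_1,\dots,L_w$ be pairwise orthogonal Latin squares of order $s$ on the cells $(i,j)$, $0\le i,j\le s-1$. Call two distinct cells first associates if they lie in different rows, different columns and carry different symbols in each $L_k$. Suppose one of the following holds: (iii) $s>(s-1-w-1)^2$, and for every cell $t$ the $(s-1-w)(s-1)$ first associates of $t$ can be divided into $s-1-w$ pairwise disjoint sets $A_1,\dots,A_{s-1-w}$ such that each $\{t\}\cup A_i$ is a common transversal of $L_1,\dots,L_w$; (v) for every cell $t$ there is chosen a division of its first associates into $s-1-w$ pairwise disjoint sets $A^t_1,\dots,A^t_{s-1-w}$ with each $\{t\}\cup A^t_i$ a common transversal, such that for any two distinct first associates $t_1,t_2$, writing $A^1_i=A^{t_1}_i$, $A^2_j=A^{t_2}_j$ and letting $t_2\in A^1_{i_1}$, $t_1\in A^2_{j_1}$: (a) $\{t_1\}\cup A^1_{i_1}=\{t_2\}\cup A^2_{j_1}$; (b) for every $i_2\neq i_1$ there is exactly one $j_2\neq j_1$ with $(\{t_1\}\cup A^1_{i_2})\cap(\{t_2\}\cup A^2_{j_2})=\emptyset$, and for each $j'\notin\{j_1,j_2\}$ the intersection $(\{t_1\}\cup A^1_{i_2})\cap(\{t_2\}\cup A^2_{j'})$ is a single cell that is a first associate of both $t_1,t_2$; (c) for every $j_3\neq j_1$ there is exactly one $i_3\neq i_1$ with $(\{t_2\}\cup A^2_{j_3})\cap(\{t_1\}\cup A^1_{i_3})=\emptyset$, and for each $i'\notin\{i_1,i_3\}$ the intersection $(\{t_2\}\cup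 A^2_{j_3})\cap(\{t_1\}\cup A^1_{i'})$ is a single cell that is a first associate of both $t_1,t_2$. Then there exist Latin squares $L_{w+1},\dots,L_{s-1}$ of order $s$ such that $L_1,\dots,L_{s-1}$ are pairwise orthogonal (the POL$(s,w)$ extends to a POL$(s,s-1)$).
   Context: Two Latin squares of order $s$ are orthogonal if superimposing them yields all $s^2$ ordered pairs of symbols; a POL$(s,w)$ is a set of $w$ pairwise orthogonal Latin squares of order $s$. A common transversal of $L_1,\dots,L_w$ is a set of $s$ cells with one cell in each row and each column carrying $s$ distinct symbols in each $L_k$ (equivalently, $s$ cells pairwise first associates). -}

module Defs where

open import Level using (0ℓ)
open import Data.Nat using (ℕ; _∸_; _+_; _^_; _<_; _>_; _≤_; _≥_)
open import Data.Fin using (Fin)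
open import Data.Product using (Σ; ∃; _×_; _,_; proj₁; proj₂)
open import Data.Sum using (_⊎_; inj₁; inj₂; [_,_])
open import Relation.Nullary using (¬_)
open import Relation.Unary using (Pred; _∈_; _∪_; _∩_; ｛_｝; _≐_; Empty)
open import Relation.Binary.PropositionalEquality using (_≡_; _≢_)
open import Function.Definitions using (Injective)

Cell : ℕ → Set
Cell s = Fin s × Fin s

row col : ∀ {s} → Cell s → Fin s
row = proj₁
col = proj₂

Square : ℕ → Set
Square s = Cell s → Fin s

-- Latin: every symbol occurs exactly once in each row and each column
-- (with s symbols, injectivity along each row/column is exactly this)
IsLatin : ∀ {s} → Square s → Set
IsLatin {s} L =
  (∀ (i : Fin s) → Injective _≡_ _≡_ (λ j → L (i , j))) ×
  (∀ (j : Fin s) → Injective _≡_ _≡_ (λ i → L (i , j)))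

Orthogonal : ∀ {s} → Square s → Square s → Set
Orthogonal {s} L M = ∀ (a b : Fin s) → Σ (Cell s) λ c → L c ≡ a × M c ≡ b

IsPOL : ∀ {s} {I : Set} → (I → Square s) → Set
IsPOL {s} {I} F = (∀ k → IsLatin (F k)) × (∀ k l → k ≢ l → Orthogonal (F k) (F l))

module _ {s w : ℕ} (L : Fin w → Square s) where

  FirstAssoc : Cell s → Cell s → Set
  FirstAssoc c d = c ≢ d × row c ≢ row d × col c ≢ col d × (∀ k → L k c ≢ L k d)

  CommonTransversal : Pred (Cell s) 0ℓ → Set
  CommonTransversal T =
    (∀ i → Σ (Fin s) λ j → (i , j) ∈ T × (∀ j' → (i , j') ∈ T → j' ≡ j)) ×
    (∀ j → Σ (Fin s) λ i → (i , j) ∈ T × (∀ i' → (i' , j) ∈ T → i' ≡ i)) ×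
    (∀ k c d → c ∈ T → d ∈ T → c ≢ d → L k c ≢ L k d)

  GoodDivision : (m : ℕ) → Cell s → (Fin m → Pred (Cell s) 0ℓ) → Set
  GoodDivision m t A =
    (∀ i c → c ∈ A i → FirstAssoc t c) ×
    (∀ c → FirstAssoc t c → Σ (Fin m) λ i → c ∈ A i) ×
    (∀ i j c → c ∈ A i → c ∈ A j → i ≡ j) ×
    (∀ i → CommonTransversal (｛ t ｝ ∪ A i))

  m : ℕ
  m = s ∸ 1 ∸ w

  Cond-iii : Set₁
  Cond-iii = (s > (s ∸ 1 ∸ w ∸ 1) ^ 2) ×
    (∀ t → Σ (Fin m → Pred (Cell s) 0ℓ) λ A → GoodDivision m t A)

  ClauseB : Cell s → Cell s → (B1 B2 : Fin m → Pred (Cell s) 0ℓ) → Fin m → Fin m → Set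
  ClauseB t1 t2 B1 B2 i1 j1 = ∀ i2 → i2 ≢ i1 →
    Σ (Fin m) λ j2 → j2 ≢ j1 × Empty (B1 i2 ∩ B2 j2) ×
      (∀ j → j ≢ j1 → Empty (B1 i2 ∩ B2 j) → j ≡ j2) ×
      (∀ j' → j' ≢ j1 → j' ≢ j2 →
        Σ (Cell s) λ c → (B1 i2 ∩ B2 j') ≐ ｛ c ｝ × FirstAssoc t1 c × FirstAssoc t2 c)

  Cond-v : Set₁
  Cond-v = Σ (Cell s → Fin m → Pred (Cell s) 0ℓ) λ A →
    (∀ t → GoodDivision m t (A t)) ×
    (∀ t1 t2 → FirstAssoc t1 t2 → ∀ i1 j1 → t2 ∈ A t1 i1 → t1 ∈ A t2 j1 →
      let B1 = λ i → ｛ t1 ｝ ∪ A t1 i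
          B2 = λ j → ｛ t2 ｝ ∪ A t2 j
      in (B1 i1 ≐ B2 j1) ×
         ClauseB t1 t2 B1 B2 i1 j1 ×
         ClauseB t2 t1 B2 B1 j1 i1)

{-# OPTIONS --safe #-}

-- Together with the rows, the columns and the symbol classes of the L k, the transversals {t} ∪ A i
-- are the lines of an affine plane of order s on the cells, as soon as any two first associates lie
-- on exactly one of them. This is what (v)(a) says. Under (iii) it holds because a transversal S
-- through q different from all blocks {q} ∪ A i would meet each of the m = s - 1 - w blocks in at
-- most m - 2 cells besides q, whence s - 1 ≤ m (m - 2), that is s ≤ (m - 1)². A cell p outside a
-- block B has m - 1 first associates on B, lying on distinct blocks through p, so exactly one of the
-- m blocks through p misses B. Hence the blocks fall into m parallel classes, and these are the
-- symbol classes of the new squares.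
module Submission where

open import Defs
open import Data.Nat using (ℕ; zero; suc; _∸_; _+_; _*_; _^_; _≥_; _<_; s≤s⁻¹)
open import Data.Nat.Properties using (+-comm; m+n∸n≡m; m≤n⇒∃[o]m+o≡n)
open import Data.Nat.Tactic.RingSolver using (solve-∀)
open import Data.Fin using (Fin; zero; suc; punchIn; punchOut; combine; remQuot)
open import Data.Fin.Properties
  using (_≟_; any?; all?; ¬∀⟶∃¬; pigeonhole; <⇒≢; suc-injective; punchIn-injective; punchInᵢ≢i;
         punchIn-punchOut; punchOut-injective; combine-injective; combine-remQuot)
open import Data.Product using (Σ; ∃; ∃₂; _×_; _,_; proj₁; proj₂; uncurry)
open import Data.Product.Properties using (×-≡,≡→≡)
open import Data.Sum using (_⊎_; inj₁; inj₂; [_,_])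
open import Data.Empty using (⊥; ⊥-elim)
open import Function using (_∘_)
open import Function.Definitions using (Injective)
open import Level using (0ℓ)
open import Relation.Nullary using (¬_; yes; no; contradiction)
open import Relation.Nullary.Decidable using (decidable-stable)
open import Relation.Unary using (Pred; _∈_; _∪_; ｛_｝)
open import Relation.Binary.PropositionalEquality
  using (_≡_; _≢_; _≗_; refl; sym; trans; cong; cong₂; subst)

-- Counting in finite sets.

-- Induction on `a`, deleting the value `g zero` by `punchOut`. The exact size `b` of the rest
-- matters: `b = 0` yields surjectivity, and one left over will be the unique parallel.
complement : ∀ {a b n} → n ≡ a + b → (g : Fin a → Fin n) → Injective _≡_ _≡_ g →
  Σ (Fin b → Fin n) λ h → Injective _≡_ _≡_ h × (∀ i j → g i ≢ h j) ×
    (∀ x → (∃ λ i → g i ≡ x) ⊎ (∃ λ j → h j ≡ x))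
complement {zero} refl g g-inj = (λ x → x) , (λ eq → eq) , (λ ()) , λ x → inj₂ (x , refl)
complement {suc a} refl g g-inj = punchIn g₀ ∘ h , h-inj ∘ punchIn-injective g₀ _ _ , disjoint , cover
  where
  g₀ = g zero
  g₀≢ : ∀ i → g₀ ≢ g (suc i)
  g₀≢ i eq with () ← g-inj eq
  rest = complement {a} refl (λ i → punchOut (g₀≢ i))
    (suc-injective ∘ g-inj ∘ punchOut-injective (g₀≢ _) (g₀≢ _))
  h = proj₁ rest
  h-inj = proj₁ (proj₂ rest)
  disjoint : ∀ i j → g i ≢ punchIn g₀ (h j)
  disjoint zero j eq = punchInᵢ≢i g₀ (h j) (sym eq)
  disjoint (suc i) j eq = proj₁ (proj₂ (proj₂ rest)) i j
    (punchIn-injective g₀ _ _ (trans (punchIn-punchOut (g₀≢ i)) eq))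
  cover : ∀ x → (∃ λ i → g i ≡ x) ⊎ (∃ λ j → punchIn g₀ (h j) ≡ x)
  cover x with g₀ ≟ x
  ... | yes eq = inj₁ (zero , eq)
  ... | no g₀≢x with proj₂ (proj₂ (proj₂ rest)) (punchOut g₀≢x)
  ...   | inj₁ (i , eq) = inj₁ (suc i , punchOut-injective (g₀≢ i) g₀≢x eq)
  ...   | inj₂ (j , eq) = inj₂ (j , trans (cong (punchIn g₀) eq) (punchIn-punchOut g₀≢x))

injective⇒surjective : ∀ {n} {f : Fin n → Fin n} → Injective _≡_ _≡_ f → ∀ y → ∃ λ x → f x ≡ y
injective⇒surjective {n} {f} f-inj y with proj₂ (proj₂ (proj₂ (complement {b = 0} (+-comm 0 n) f f-inj))) y
... | inj₁ p = p

-- Orthogonality as separation of cells.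

Separates : ∀ {s} → Square s → Square s → Set
Separates L M = ∀ {c d} → L c ≡ L d → M c ≡ M d → c ≡ d

-- Orthogonality gives a right inverse `section` of `code`. It is injective between sets of size
-- `s * s`, hence bijective, so `code` is injective.
orthogonal⇒separates : ∀ {s} {L M : Square s} → Orthogonal L M → Separates L M
orthogonal⇒separates {s} {L} {M} orth {c} {d} Lc≡Ld Mc≡Md =
  trans (sym (section-code c)) (trans (cong section codes≡) (section-code d))
  where
  section : Fin (s * s) → Cell s
  section = proj₁ ∘ uncurry orth ∘ remQuot s
  code : Cell s → Fin (s * s)
  code c = combine (L c) (M c)
  code-section : ∀ u → code (section u) ≡ u
  code-section u = let (_ , eqL , eqM) = uncurry orth (remQuot s u) in
    trans (cong₂ combine eqL eqM) (combine-remQuot {s} s u)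
  flatten : Cell s → Fin (s * s)
  flatten = uncurry combine
  flatten-injective : ∀ {c d} → flatten c ≡ flatten d → c ≡ d
  flatten-injective eq = ×-≡,≡→≡ (combine-injective _ _ _ _ eq)
  section-surjective = injective⇒surjective {f = flatten ∘ section}
    λ {u} {v} eq → trans (sym (code-section u)) (trans (cong code (flatten-injective eq)) (code-section v))
  section-code : ∀ c → section (code c) ≡ c
  section-code c with section-surjective (flatten c)
  ... | u , eq with refl ← flatten-injective {section u} {c} eq = cong section (code-section u)
  codes≡ : code c ≡ code d
  codes≡ = cong₂ combine Lc≡Ld Mc≡Md

-- Lines as graphs of maps.

-- Sets with exactly one cell in each row are encoded by the maps from rows to columns whose graphs
-- they are.
_on_ : ∀ {s} → Cell s → (Fin s → Fin s) → Set
c on f = f (row c) ≡ col c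

on⇒≡ : ∀ {s} (f : Fin s → Fin s) {c} → c on f → (row c , f (row c)) ≡ c
on⇒≡ f c∈f = cong (_ ,_) c∈f

_∥_ : ∀ {s} → (Fin s → Fin s) → (Fin s → Fin s) → Set
f ∥ g = f ≗ g ⊎ (∀ x → f x ≢ g x)

∥-sym : ∀ {s} {f g : Fin s → Fin s} → f ∥ g → g ∥ f
∥-sym (inj₁ eq) = inj₁ λ x → sym (eq x)
∥-sym (inj₂ ne) = inj₂ λ x → ne x ∘ sym

∥-meet : ∀ {s} {f g : Fin s → Fin s} → f ∥ g → ∀ x → f x ≡ g x → f ≗ g
∥-meet (inj₁ eq) _ _ = eq
∥-meet (inj₂ ne) x eq = contradiction eq (ne x)

≗-∥ : ∀ {s} {f g h : Fin s → Fin s} → f ≗ g → g ∥ h → f ∥ h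
≗-∥ f≗g (inj₁ g≗h) = inj₁ λ x → trans (f≗g x) (g≗h x)
≗-∥ f≗g (inj₂ ne) = inj₂ λ x → ne x ∘ trans (sym (f≗g x))

-- Transversals of a net.

-- ℓ e labels the e-th parallel class of lines of a net.
module Net {s K : ℕ} (ℓ : Fin K → Square s)
  (separated : ∀ {e e′} → e ≢ e′ → Separates (ℓ e) (ℓ e′)) where

  Transversal : (Fin s → Fin s) → Set
  Transversal f = ∀ e → Injective _≡_ _≡_ (λ x → ℓ e (x , f x))

  Associate : Cell s → Cell s → Set
  Associate c d = ∀ e → ℓ e c ≢ ℓ e d

  transversal-≗ : ∀ {f g} → f ≗ g → Transversal f → Transversal g
  transversal-≗ f≗g T e {x} {y} eq = T e
    (trans (cong (λ z → ℓ e (x , z)) (f≗g x)) (trans eq (cong (λ z → ℓ e (y , z)) (sym (f≗g y)))))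

  transversal-on : ∀ {f} → Transversal f → ∀ e {c d} → c on f → d on f → ℓ e c ≡ ℓ e d → row c ≡ row d
  transversal-on {f} T e c∈f d∈f eq =
    T e (trans (cong (ℓ e) (on⇒≡ f c∈f)) (trans eq (cong (ℓ e) (sym (on⇒≡ f d∈f)))))

  module Foot {f} (T : Transversal f) {p} (p∉f : ¬ p on f) where

    foot : Fin K → Fin s
    foot e = proj₁ (injective⇒surjective (T e) (ℓ e p))

    ℓ-foot : ∀ e → ℓ e (foot e , f (foot e)) ≡ ℓ e p
    ℓ-foot e = proj₂ (injective⇒surjective (T e) (ℓ e p))

    foot-unique : ∀ e x → ℓ e (x , f x) ≡ ℓ e p → x ≡ foot e
    foot-unique e x eq = T e (trans eq (sym (ℓ-foot e)))

    -- A cell of `f` that is the foot for two classes shares two lines with `p`, so it equals `p`,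
    -- which is off `f`.
    foot-injective : Injective _≡_ _≡_ foot
    foot-injective {e} {e′} eq with e ≟ e′
    ... | yes e≡e′ = e≡e′
    ... | no e≢e′ = contradiction (subst (_on f) (separated e≢e′ (ℓ-foot e) ℓ-foot′) refl) p∉f
      where
      ℓ-foot′ : ℓ e′ (foot e , f (foot e)) ≡ ℓ e′ p
      ℓ-foot′ = subst (λ x → ℓ e′ (x , f x) ≡ ℓ e′ p) (sym eq) (ℓ-foot e′)

  -- The cell `(y , g y)` is off `f`, and at none of its `K` feet on `f` can `g` agree: `g` would
  -- meet one line of a class twice. Discarding `r` as well leaves `a` candidate rows.
  agreement : ∀ {a} → s ≡ suc K + a → ∀ {f g} → Transversal f → Transversal g →
    ∀ {r} → f r ≡ g r → (∃ λ y → f y ≢ g y) →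
    Σ (Fin a → Fin s) λ h → ∀ x → x ≢ r → f x ≡ g x → ∃ λ k → h k ≡ x
  agreement {a} s≡ {f} {g} F G {r} fr≡gr (y , fy≢gy) = proj₁ rest , covered
    where
    open Foot F {y , g y} fy≢gy
    foot-disagrees : ∀ e → f (foot e) ≢ g (foot e)
    foot-disagrees e eq = fy≢gy (subst (λ x → f x ≡ g x) foot≡y eq)
      where
      foot≡y : foot e ≡ y
      foot≡y = G e (trans (cong (λ z → ℓ e (foot e , z)) (sym eq)) (ℓ-foot e))
    excluded : Fin (suc K) → Fin s
    excluded zero = r
    excluded (suc e) = foot e
    excluded-injective : Injective _≡_ _≡_ excluded
    excluded-injective {zero} {zero} _ = refl
    excluded-injective {zero} {suc e} refl = contradiction fr≡gr (foot-disagrees e)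
    excluded-injective {suc e} {zero} refl = contradiction fr≡gr (foot-disagrees e)
    excluded-injective {suc e} {suc e′} eq = cong suc (foot-injective eq)
    rest = complement s≡ excluded excluded-injective
    covered : ∀ x → x ≢ r → f x ≡ g x → ∃ λ k → proj₁ rest k ≡ x
    covered x x≢r fx≡gx with proj₂ (proj₂ (proj₂ rest)) x
    ... | inj₁ (zero , eq) = contradiction (sym eq) x≢r
    ... | inj₁ (suc e , refl) = contradiction fx≡gx (foot-disagrees e)
    ... | inj₂ k = k

  -- Spreads of blocks and the counting bound.

  record Spread (m : ℕ) : Set where
    field
      block : Cell s → Fin m → Fin s → Fin s
      block-transversal : ∀ t i → Transversal (block t i)
      through : ∀ t i → t on block t i
      cover : ∀ {t c} → Associate t c → ∃ λ i → c on block t i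
      unique : ∀ {t c i j} → c ≢ t → c on block t i → c on block t j → i ≡ j

    -- This turns the blocks chosen at the separate cells into one family of lines. Clause (a) of
    -- (v) grants it; under (iii) counting forces it.
    Consistent : Set
    Consistent = ∀ {t i c} → c on block t i → ∃ λ j → block c j ≗ block t i

  module _ {m : ℕ} (S : Spread m) where
    open Spread S

    transversal-is-block : ∀ {a} → s ≡ suc K + a → m * a < s ∸ 1 →
      ∀ {f} → Transversal f → ∀ {q} → q on f → ∃ λ j → block q j ≗ f
    transversal-is-block {a} s≡ small {f} T {q} q∈f
      with any? (λ j → all? (λ x → block q j x ≟ f x))
    ... | yes found = found
    ... | no none = ⊥-elim (collide s≡ small)
      where
      r = row q
      differs : ∀ j → ∃ λ y → block q j y ≢ f y
      differs j = ¬∀⟶∃¬ s _ (λ x → block q j x ≟ f x) (λ eq → none (j , eq))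
      agree = λ j → agreement s≡ (block-transversal q j) T (trans (through q j) (sym q∈f)) (differs j)
      associate : ∀ x → x ≢ r → Associate q (x , f x)
      associate x x≢r e eq = x≢r (sym (transversal-on T e q∈f refl eq))
      index : ∀ x → x ≢ r → Fin m
      index x x≢r = proj₁ (cover (associate x x≢r))
      position : ∀ x (x≢r : x ≢ r) → ∃ λ k → proj₁ (agree (index x x≢r)) k ≡ x
      position x x≢r = proj₂ (agree (index x x≢r)) x x≢r (proj₂ (cover (associate x x≢r)))
      -- A row is coded by the block through `q` that contains its cell of `f`, together with its
      -- place in the list of agreements of that block with `f`.
      code : ∀ x → x ≢ r → Fin (m * a)
      code x x≢r = combine (index x x≢r) (proj₁ (position x x≢r))
      code-injective : ∀ {x y} x≢r y≢r → code x x≢r ≡ code y y≢r → x ≡ y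
      code-injective x≢r y≢r eq =
        let (j≡ , k≡) = combine-injective _ _ _ _ eq in
        trans (sym (proj₂ (position _ x≢r)))
          (trans (cong₂ (λ j k → proj₁ (agree j) k) j≡ k≡) (proj₂ (position _ y≢r)))
      collide : ∀ {n} → s ≡ suc n → m * a < s ∸ 1 → ⊥
      collide refl lt =
        -- `punchIn r` enumerates the `s - 1` rows other than that of `q`, too many for `m * a`
        -- codes.
        let (x , y , x<y , eq) = pigeonhole lt (λ x → code (punchIn r x) (punchInᵢ≢i r x)) in
        <⇒≢ x<y (punchIn-injective r x y (code-injective _ _ eq))

    -- The affine plane and its parallel classes.

    module Plane (consistent : Consistent) {a : ℕ} (s≡ : s ≡ K + a) (m≡ : m ≡ a + 1)
      (other : ∀ (x : Fin s) → ∃ λ y → y ≢ x) where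

      Block : (Fin s → Fin s) → Set
      Block f = ∃₂ λ t i → block t i ≗ f

      Block-transversal : ∀ {f} → Block f → Transversal f
      Block-transversal (t , i , eq) = transversal-≗ eq (block-transversal t i)

      Block-at : ∀ {f} → Block f → ∀ {c} → c on f → ∃ λ j → block c j ≗ f
      Block-at (t , i , eq) {c} c∈f =
        let (j , eq′) = consistent {t} {i} {c} (trans (eq (row c)) c∈f) in
        j , λ x → trans (eq′ x) (eq x)

      -- By consistency both lines are blocks at their first common cell, and `unique` at the second
      -- one identifies them.
      two-points : ∀ {f g} → Block f → Block g → ∀ {x y} → x ≢ y → f x ≡ g x → f y ≡ g y → f ≗ g
      two-points {f} {g} F G {x} {y} x≢y fx≡gx fy≡gy z =
        let (j , j-f) = Block-at F {x , f x} refl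
            (k , k-g) = Block-at G {x , f x} (sym fx≡gx)
            j≡k = unique {c = y , f y} (x≢y ∘ sym ∘ cong row) (j-f y) (trans (k-g y) (sym fy≡gy))
        in trans (sym (j-f z)) (trans (cong (λ i → block _ i z) j≡k) (k-g z))

      block-injective : ∀ {t i j} → block t i ≗ block t j → i ≡ j
      block-injective {t} {i} eq = let (y , y≢) = other (row t) in
        unique {c = y , block t i y} (y≢ ∘ cong row) refl (sym (eq y))

      -- Playfair's axiom for `p` and `f`.
      Parallel : Cell s → (Fin s → Fin s) → Set
      Parallel p f = ∃ λ j → block p j ∥ f × (∀ k → block p k ∥ f → k ≡ j)

      parallel-on : ∀ {f} → Block f → ∀ {p} → p on f → Parallel p f
      parallel-on F {p} p∈f = let (j , eq) = Block-at F p∈f in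
        j , inj₁ eq , λ k k∥f →
          block-injective λ x →
            trans (∥-meet k∥f (row p) (trans (through p k) (sym p∈f)) x) (sym (eq x))

      parallel-off : ∀ {f} → Block f → ∀ {p} → ¬ p on f → Parallel p f
      parallel-off {f} F {p} p∉f = missing , inj₂ disjoint , missing-unique
        where
        open Foot (Block-transversal F) p∉f
        rest = complement s≡ foot foot-injective
        joined = proj₁ rest
        associate : ∀ k → Associate p (joined k , f (joined k))
        associate k e eq =
          proj₁ (proj₂ (proj₂ rest)) e k (sym (foot-unique e (joined k) (sym eq)))
        index : Fin a → Fin m
        index k = proj₁ (cover (associate k))
        index-on : ∀ k → block p (index k) (joined k) ≡ f (joined k)
        index-on k = proj₂ (cover (associate k))
        index-injective : Injective _≡_ _≡_ index
        index-injective {k} {l} eq with joined k ≟ joined l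
        ... | yes same = proj₁ (proj₂ rest) same
        -- A block through `p` meeting `f` in two cells would be `f`, which misses `p`.
        ... | no differ = contradiction (trans (sym (f≗ (row p))) (through p (index k))) p∉f
          where
          f≗ : block p (index k) ≗ f
          f≗ = two-points (p , index k , λ _ → refl) F differ (index-on k)
            (subst (λ i → block p i (joined l) ≡ f (joined l)) (sym eq) (index-on l))
        indices = complement m≡ index index-injective
        missing = proj₁ indices zero
        disjoint : ∀ x → block p missing x ≢ f x
        disjoint x eq with proj₂ (proj₂ (proj₂ rest)) x
        -- At a foot, the common cell and `p` would lie on one line of class `e` and on the same
        -- transversal, so in the same row, putting `p` on `f`.
        ... | inj₁ (e , refl) = p∉f (subst (λ y → f y ≡ col p) foot≡p
                (trans (sym eq) (trans (cong (block p missing) foot≡p) (through p missing))))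
          where
          foot≡p : foot e ≡ row p
          foot≡p = transversal-on (block-transversal p missing) e eq (through p missing) (ℓ-foot e)
        ... | inj₂ (k , refl) = proj₁ (proj₂ (proj₂ indices)) k zero
                (unique {c = joined k , f (joined k)} (λ c≡p → p∉f (subst (_on f) c≡p refl)) (index-on k) eq)
        missing-unique : ∀ k → block p k ∥ f → k ≡ missing
        missing-unique k k∥f with proj₂ (proj₂ (proj₂ indices)) k
        ... | inj₁ (i , refl) =
                contradiction (trans (sym (∥-meet k∥f (joined i) (index-on i) (row p))) (through p k)) p∉f
        ... | inj₂ (zero , eq) = sym eq

      parallel : ∀ {f} → Block f → ∀ p → Parallel p f
      parallel {f} F p with f (row p) ≟ col p
      ... | yes p∈f = parallel-on F p∈f
      ... | no p∉f = parallel-off F p∉f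

      -- If `f` and `h` meet, both are the parallel to `g` through the common cell.
      ∥-trans : ∀ {f g h} → Block f → Block g → Block h → f ∥ g → g ∥ h → f ∥ h
      ∥-trans {f} {g} {h} F G H f∥g g∥h with any? (λ x → f x ≟ h x)
      ... | no none = inj₂ λ x eq → none (x , eq)
      ... | yes (x , fx≡hx) =
        let p = x , f x
            (j , j≗f) = Block-at F {p} refl
            (k , k≗h) = Block-at H {p} (sym fx≡hx)
            (_ , _ , only) = parallel G p
            j≡k = trans (only j (≗-∥ j≗f f∥g)) (sym (only k (≗-∥ k≗h (∥-sym g∥h))))
        in inj₁ λ y → trans (sym (j≗f y)) (trans (cong (λ i → block p i y) j≡k) (k≗h y))

      -- Parallel classes as symbol classes.

      module Classes (r : Fin s) where

        -- The `m` blocks through this one cell represent the parallel classes.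
        origin : Cell s
        origin = r , r

        base : Fin m → Fin s → Fin s
        base = block origin

        base-Block : ∀ i → Block (base i)
        base-Block i = origin , i , λ _ → refl

        line : Fin m → Cell s → Fin s → Fin s
        line i c = block c (proj₁ (parallel (base-Block i) c))

        line-Block : ∀ i c → Block (line i c)
        line-Block i c = c , _ , λ _ → refl

        line-through : ∀ i c → c on line i c
        line-through i c = through c _

        line-∥-base : ∀ i c → line i c ∥ base i
        line-∥-base i c = proj₁ (proj₂ (parallel (base-Block i) c))

        line-≗ : ∀ i c d x → line i c x ≡ line i d x → line i c ≗ line i d
        line-≗ i c d = ∥-meet (∥-trans (line-Block i c) (base-Block i) (line-Block i d)
          (line-∥-base i c) (∥-sym (line-∥-base i d)))

        -- Disjoint lines would make `base i` and `base k` parallel; as both pass through `origin`,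
        -- they would coincide.
        lines-meet : ∀ {i k} → i ≢ k → ∀ c d → ∃ λ x → line i c x ≡ line k d x
        lines-meet {i} {k} i≢k c d with any? (λ x → line i c x ≟ line k d x)
        ... | yes meet = meet
        ... | no none = contradiction (block-injective (∥-meet bases-∥ r
                (trans (through origin i) (sym (through origin k))))) i≢k
          where
          bases-∥ : base i ∥ base k
          bases-∥ =
            ∥-trans (base-Block i) (line-Block i c) (base-Block k) (∥-sym (line-∥-base i c))
              (∥-trans (line-Block i c) (line-Block k d) (base-Block k)
                (inj₂ λ x eq → none (x , eq)) (line-∥-base k d))

        -- The symbol of `c` is the column where its line of class `i` crosses the fixed row `r`, so
        -- the lines of the class are the symbol classes.
        square : Fin m → Square s
        square i c = line i c r

        square-on : ∀ i b {c} → c on line i (r , b) → square i c ≡ b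
        square-on i b {c} c∈ = trans
          (line-≗ i c (r , b) (row c) (trans (line-through i c) (sym c∈)) r)
          (line-through i (r , b))

        orthogonal-ℓ : ∀ e i → Orthogonal (ℓ e) (square i)
        orthogonal-ℓ e i a b =
          let f = line i (r , b)
              (x , eq) = injective⇒surjective (Block-transversal (line-Block i (r , b)) e) a
          in (x , f x) , eq , square-on i b refl

        orthogonal-square : ∀ i k → i ≢ k → Orthogonal (square i) (square k)
        orthogonal-square i k i≢k a b =
          let (x , eq) = lines-meet i≢k (r , a) (r , b)
          in (x , line i (r , a) x) , square-on i a refl , square-on k b (sym eq)

-- From Latin squares to nets and back.

orthogonal-sym : ∀ {s} {L M : Square s} → Orthogonal L M → Orthogonal M L
orthogonal-sym orth a b = let (c , eq , eq′) = orth b a in c , eq′ , eq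

-- With rows and columns treated as squares, Latinity is one more case of orthogonality, so
-- `orthogonal-ℓ` supplies it too.
orthogonal-row-col⇒latin : ∀ {s} {M : Square s} → Orthogonal row M → Orthogonal col M → IsLatin M
orthogonal-row-col⇒latin R C =
  (λ i eq → cong col (orthogonal⇒separates R {i , _} {i , _} refl eq)) ,
  (λ j eq → cong row (orthogonal⇒separates C {_ , j} {_ , j} refl eq))

module _ {s w : ℕ} (L : Fin w → Square s) (pol : IsPOL L) where

  classes : Fin (2 + w) → Square s
  classes zero = row
  classes (suc zero) = col
  classes (suc (suc k)) = L k

  classes-separated : ∀ {e e′} → e ≢ e′ → Separates (classes e) (classes e′)
  classes-separated {zero} {zero} ne = contradiction refl ne
  classes-separated {zero} {suc zero} _ eq eq′ = ×-≡,≡→≡ (eq , eq′)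
  classes-separated {zero} {suc (suc k)} _ {r , _} refl eq = cong (r ,_) (proj₁ (proj₁ pol k) r eq)
  classes-separated {suc zero} {zero} _ eq eq′ = ×-≡,≡→≡ (eq′ , eq)
  classes-separated {suc zero} {suc zero} ne = contradiction refl ne
  classes-separated {suc zero} {suc (suc k)} _ {_ , c} refl eq = cong (_, c) (proj₂ (proj₁ pol k) c eq)
  classes-separated {suc (suc k)} {zero} _ {r , _} eq refl = cong (r ,_) (proj₁ (proj₁ pol k) r eq)
  classes-separated {suc (suc k)} {suc zero} _ {_ , c} eq refl = cong (_, c) (proj₂ (proj₁ pol k) c eq)
  classes-separated {suc (suc k)} {suc (suc l)} ne =
    orthogonal⇒separates (proj₂ pol k l λ { refl → ne refl })

  open Net classes (λ {e} {e′} → classes-separated {e} {e′})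

  associate⇒first : ∀ {c d} → Associate c d → FirstAssoc L c d
  associate⇒first as = (λ { refl → as zero refl }) , as zero , as (suc zero) , λ k → as (suc (suc k))

  first-sym : ∀ {c d} → FirstAssoc L c d → FirstAssoc L d c
  first-sym (c≢d , r≢ , c≢ , L≢) = c≢d ∘ sym , r≢ ∘ sym , c≢ ∘ sym , λ k → L≢ k ∘ sym

  module _ {T : Pred (Cell s) 0ℓ} (ct : CommonTransversal L T) where

    graph : Fin s → Fin s
    graph i = proj₁ (proj₁ ct i)

    graph∈ : ∀ i → (i , graph i) ∈ T
    graph∈ i = proj₁ (proj₂ (proj₁ ct i))

    on⇒∈ : ∀ {c} → c on graph → c ∈ T
    on⇒∈ {i , _} refl = graph∈ i

    ∈⇒on : ∀ {c} → c ∈ T → c on graph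
    ∈⇒on {i , j} c∈T = sym (proj₂ (proj₂ (proj₁ ct i)) j c∈T)

    graph-transversal : Transversal graph
    graph-transversal zero eq = eq
    graph-transversal (suc zero) {x} {y} eq =
      trans (only x (graph∈ x)) (sym (only y (subst (λ j → (y , j) ∈ T) (sym eq) (graph∈ y))))
      where only = proj₂ (proj₂ (proj₁ (proj₂ ct) (graph x)))
    graph-transversal (suc (suc k)) {x} {y} eq = decidable-stable (x ≟ y) λ x≢y →
      proj₂ (proj₂ ct) k _ _ (graph∈ x) (graph∈ y) (x≢y ∘ cong row) eq

  module _ {m : ℕ} (A : Cell s → Fin m → Pred (Cell s) 0ℓ) (good : ∀ t → GoodDivision L m t (A t)) where

    common : ∀ t i → CommonTransversal L (｛ t ｝ ∪ A t i)
    common t = proj₂ (proj₂ (proj₂ (good t)))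

    on⇒member : ∀ {t i c} → c ≢ t → c on graph (common t i) → c ∈ A t i
    on⇒member {t} {i} c≢t c∈ with on⇒∈ (common t i) c∈
    ... | inj₁ t≡c = contradiction (sym t≡c) c≢t
    ... | inj₂ c∈A = c∈A

    division : Spread m
    division = record
      { block = λ t i → graph (common t i)
      ; block-transversal = λ t i → graph-transversal (common t i)
      ; through = λ t i → ∈⇒on (common t i) (inj₁ refl)
      ; cover = λ {t} {c} as →
          let (i , c∈A) = proj₁ (proj₂ (good t)) c (associate⇒first as) in
          i , ∈⇒on (common t i) (inj₂ c∈A)
      ; unique = λ {t} {c} {i} {j} c≢t c∈i c∈j →
          proj₁ (proj₂ (proj₂ (good t))) i j c (on⇒member c≢t c∈i) (on⇒member c≢t c∈j)
      }

  -- Completion under each hypothesis.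

  completion : ∀ {m a} (S : Spread m) → Spread.Consistent S → s ≡ 2 + w + a → m ≡ a + 1 →
    Σ (Fin m → Square s) λ M → IsPOL [ L , M ]
  completion S consistent refl m≡ = square , latin , orthogonal
    where
    other : ∀ x → ∃ λ y → y ≢ x
    other x = punchIn x zero , punchInᵢ≢i x zero
    open Plane S consistent refl m≡ other
    open Classes zero
    latin : ∀ k → IsLatin ([ L , square ] k)
    latin (inj₁ k) = proj₁ pol k
    latin (inj₂ i) = orthogonal-row-col⇒latin (orthogonal-ℓ zero i) (orthogonal-ℓ (suc zero) i)
    orthogonal : ∀ k l → k ≢ l → Orthogonal ([ L , square ] k) ([ L , square ] l)
    orthogonal (inj₁ k) (inj₁ l) ne = proj₂ pol k l (ne ∘ cong inj₁)
    orthogonal (inj₁ k) (inj₂ i) _ = orthogonal-ℓ (suc (suc k)) i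
    orthogonal (inj₂ i) (inj₁ k) _ = orthogonal-sym (orthogonal-ℓ (suc (suc k)) i)
    orthogonal (inj₂ i) (inj₂ j) ne = orthogonal-square i j (ne ∘ cong inj₂)

  completion-v : ∀ {a} → s ≡ 2 + w + a → s ∸ 1 ∸ w ≡ a + 1 → Cond-v L →
    Σ (Fin (s ∸ 1 ∸ w) → Square s) λ M → IsPOL [ L , M ]
  completion-v s≡ m≡ (A , good , pairs) = completion S consistent s≡ m≡
    where
    S = division A good
    open Spread S
    consistent : Consistent
    consistent {t} {i} {c} c∈ with row c ≟ row t
    -- Two cells of a graph in the same row coincide, so `c` is `t`.
    ... | yes same with refl ← trans (sym (on⇒≡ (block t i) c∈))
                          (trans (cong (λ x → x , block t i x) same) (on⇒≡ (block t i) (through t i))) =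
          i , λ _ → refl
    ... | no differ =
      let c∈A = on⇒member A good (differ ∘ cong row) c∈
          assoc = proj₁ (good t) i c c∈A
          (j , t∈A) = proj₁ (proj₂ (good c)) t (first-sym assoc)
          ((_ , ⊇) , _) = pairs t c assoc i j c∈A t∈A
      -- Both sets are graphs of maps, so the inclusion from clause (a) makes the maps equal.
      in j , λ x → sym (∈⇒on (common A good t i) (⊇ (graph∈ (common A good c j) x)))

  completion-iii : ∀ {a} → s ≡ 3 + w + a → s ∸ 1 ∸ w ≡ 2 + a → Cond-iii L →
    Σ (Fin (s ∸ 1 ∸ w) → Square s) λ M → IsPOL [ L , M ]
  completion-iii {a} s≡ m≡ (bound , divisions) =
    completion S (λ {t} {i} → transversal-is-block S s≡ small (block-transversal t i)) s≡′ m≡′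
    where
    S = division (proj₁ ∘ divisions) (proj₂ ∘ divisions)
    open Spread S
    -- Here `a` is `m - 2`, the bound for `agreement`, which also discards the common row; the plane
    -- counts `m - 1` cells of a line joined to an outside cell.
    s≡′ : s ≡ 2 + w + suc a
    s≡′ = trans s≡ (shift w a)
      where
      shift : ∀ w a → 3 + w + a ≡ 2 + w + (1 + a)
      shift = solve-∀
    m≡′ : s ∸ 1 ∸ w ≡ suc a + 1
    m≡′ = trans m≡ (+-comm 1 (suc a))
    square-minus-one : ∀ a → (1 + a) * ((1 + a) * 1) ≡ suc ((2 + a) * a)
    square-minus-one = solve-∀
    predecessor : ∀ {k n} → suc k < n → k < n ∸ 1
    predecessor {n = suc n} lt = s≤s⁻¹ lt
    -- As `(m - 1)^2` equals `m * (m - 2) + 1`, the bound in (iii) says exactly that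
    -- `m * a < s - 1`.
    small : (s ∸ 1 ∸ w) * a < s ∸ 1
    small = subst (λ n → n * a < s ∸ 1) (sym m≡) (predecessor
      (subst (_< s) (trans (cong (λ n → (n ∸ 1) ^ 2) m≡) (square-minus-one a)) bound))

theorem3p12 : (s w : ℕ) → w ≥ 1 → s ≥ w + 4 →
    (L : Fin w → Square s) → IsPOL L →
    Cond-iii L ⊎ Cond-v L →
    Σ (Fin (s ∸ 1 ∸ w) → Square s) λ M → IsPOL [ L , M ]
theorem3p12 s w _ s≥w+4 L pol with n , refl ← m≤n⇒∃[o]m+o≡n s≥w+4 =
  -- With `s = w + 4 + n` one has `m = 3 + n`, so `a` is `m - 2 = 1 + n` in the first case and
  -- `m - 1 = 2 + n` in the second.
  [ completion-iii L pol (order₃ w n) deficiency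
  , completion-v L pol (order₂ w n) (trans deficiency (+-comm 1 (2 + n))) ]
  where
  order₃ : ∀ w n → w + 4 + n ≡ 3 + w + (1 + n)
  order₃ = solve-∀
  order₂ : ∀ w n → w + 4 + n ≡ 2 + w + (2 + n)
  order₂ = solve-∀
  reorder : ∀ w n → w + 4 + n ≡ 4 + n + w
  reorder = solve-∀
  deficiency : w + 4 + n ∸ 1 ∸ w ≡ 3 + n
  deficiency = trans (cong (λ k → k ∸ 1 ∸ w) (reorder w n)) (m+n∸n≡m (3 + n) w)
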